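{- Let $n\ge 1$ and let $[n]=\{1,2,\ldots,n\}$ be the chain with its usual total order. Let $Z_{[n]}$ be its zeta matrix, i.e. the $n\times n$ matrix with $(i,j)$ entry equal to $1$ if $i\le j$ and $0$ otherwise, let $M_{[n]}=Z_{[n]}^{ -1}$, and set $\mathfrak{Z}_{[n]}=Z_{[n]}+Z_{[n]}^t$ and $\mathfrak{M}_{[n]}=M_{[n]}+M_{[n]}^t$. Then $$\det(\mathfrak{Z}_{[n]}) = \det(\mathfrak{M}_{[n]}) = n+1.$$
   Context: The superscript $t$ denotes transpose. -}

module Defs where

open import Algebra.Properties.Semiring.Sum using (sum; sum-cong-≗; sum-replicate-zero)
open import Data.Bool.Base using (if_then_else_)
open import Data.Fin.Base using (Fin; zero; suc; toℕ; punchIn)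
open import Data.Fin.Properties using (_≟_; _≤?_)
open import Data.Integer.Base using (ℤ; 0ℤ; 1ℤ; -1ℤ; _+_; _*_; _^_)
open import Data.Integer.Properties
  using (+-*-semiring; +-identityˡ; *-identityˡ; *-zeroʳ)
open import Data.Nat.Base using (ℕ; zero; suc)
open import Data.Product.Base using (_×_; _,_; ∃-syntax)
open import Data.Vec.Functional using (Vector; transpose)
open import Relation.Binary.PropositionalEquality
open import Relation.Nullary.Decidable.Core using (does)

Matrix : ℕ → Set
Matrix n = Vector (Vector ℤ n) n

infix  4 _≋_
infixl 6 _⊕_
infixl 7 _⊗_
infix  8 _ᵗ

-- Without function extensionality, matrices are compared entrywise.
_≋_ : ∀ {n} → Matrix n → Matrix n → Set
A ≋ B = ∀ i j → A i j ≡ B i j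

_⊕_ : ∀ {n} → Matrix n → Matrix n → Matrix n
(A ⊕ B) i j = A i j + B i j

_⊗_ : ∀ {n} → Matrix n → Matrix n → Matrix n
_⊗_ {n} A B i j = sum +-*-semiring {n} (λ k → A i k * B k j)

𝟙 : ∀ {n} → Matrix n
𝟙 i j = if does (i ≟ j) then 1ℤ else 0ℤ

_ᵗ : ∀ {n} → Matrix n → Matrix n
_ᵗ = transpose

minor : ∀ {n} → Matrix (suc n) → Fin (suc n) → Fin (suc n) → Matrix n
minor A i j k l = A (punchIn i k) (punchIn j l)

-- Laplace expansion along the first row.
det : ∀ {n} → Matrix n → ℤ
det {zero}  A = 1ℤ
det {suc n} A =
  sum +-*-semiring {suc n} (λ j → -1ℤ ^ toℕ j * A zero j * det (minor A zero j))

infix 4 _IsInverseOf_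

_IsInverseOf_ : ∀ {n} → Matrix n → Matrix n → Set
B IsInverseOf A = (B ⊗ A ≋ 𝟙) × (A ⊗ B ≋ 𝟙)

-- The chain {1 < ⋯ < n} is represented by Fin n with its usual order.
Z[_] : ∀ n → Matrix n
Z[ n ] i j = if does (i ≤? j) then 1ℤ else 0ℤ

-- The zeta matrix is invertible over ℤ, so quantifying over its inverses
-- is not vacuous, and its integer inverse is also the one over ℚ or ℝ.

private
  ∑ : ∀ {n} → Vector ℤ n → ℤ
  ∑ = sum +-*-semiring

  ∑-cong : ∀ {n} {u v : Vector ℤ n} → (∀ i → u i ≡ v i) → ∑ u ≡ ∑ v
  ∑-cong = sum-cong-≗ +-*-semiring

  ∑-zero : ∀ {n} {v : Vector ℤ n} → (∀ i → v i ≡ 0ℤ) → ∑ v ≡ 0ℤ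
  ∑-zero {n} v≡0 = trans (∑-cong v≡0) (sum-replicate-zero +-*-semiring n)

  μ : ∀ {n} → Matrix n
  μ zero    zero          = 1ℤ
  μ zero    (suc zero)    = -1ℤ
  μ zero    (suc (suc _)) = 0ℤ
  μ (suc _) zero          = 0ℤ
  μ (suc i) (suc j)       = μ i j

  Z-suc : ∀ {n} (i j : Fin n) → Z[ suc n ] (suc i) (suc j) ≡ Z[ n ] i j
  Z-suc zero    j       = refl
  Z-suc (suc i) zero    = refl
  Z-suc (suc i) (suc j) = refl

  ∑-μ : ∀ {n} (j : Fin (suc n)) → ∑ (λ k → μ k j) ≡ 𝟙 zero j
  ∑-μ {n}     zero          = cong (1ℤ +_) (∑-zero {n} λ _ → refl)
  ∑-μ {suc n} (suc zero)    = cong (-1ℤ +_) (∑-μ {n} zero)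
  ∑-μ {suc n} (suc (suc j)) = trans (+-identityˡ _) (∑-μ {n} (suc j))

  Z⊗μ : ∀ n → Z[ n ] ⊗ μ ≋ 𝟙
  Z⊗μ (suc n) zero    j       = trans (∑-cong {suc n} λ k → *-identityˡ (μ k j)) (∑-μ j)
  Z⊗μ (suc n) (suc i) zero    =
    trans (+-identityˡ _) (∑-zero {n} λ k → *-zeroʳ (Z[ suc n ] (suc i) (suc k)))
  Z⊗μ (suc n) (suc i) (suc j) = trans (+-identityˡ _)
    (trans (∑-cong {n} λ k → cong (_* μ k j) (Z-suc i k)) (Z⊗μ n i j))

  μ⊗Z : ∀ n → μ ⊗ Z[ n ] ≋ 𝟙
  μ⊗Z (suc zero)    zero    zero          = refl
  μ⊗Z (suc (suc n)) zero    zero          =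
    cong (1ℤ +_) (trans (+-identityˡ _) (∑-zero {n} λ _ → refl))
  μ⊗Z (suc (suc n)) zero    (suc zero)    =
    cong (λ x → 1ℤ + (-1ℤ + x)) (∑-zero {n} λ _ → refl)
  μ⊗Z (suc (suc n)) zero    (suc (suc j)) =
    cong (λ x → 1ℤ + (-1ℤ + x)) (∑-zero {n} λ _ → refl)
  μ⊗Z (suc n)       (suc i) zero          =
    trans (+-identityˡ _) (∑-zero {n} λ k → *-zeroʳ (μ i k))
  μ⊗Z (suc n)       (suc i) (suc j)       = trans (+-identityˡ _)
    (trans (∑-cong {n} λ k → cong (μ i k *_) (Z-suc k j)) (μ⊗Z n i j))

Z-invertible : ∀ n → ∃[ M ] M IsInverseOf Z[ n ]
Z-invertible n = μ , μ⊗Z n , Z⊗μ n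

{-# OPTIONS --safe #-}

-- Both determinants are computed from their first columns. In Z + Zᵗ,
-- subtracting the second column from the first leaves (1, -1, 0, …, 0), and
-- the two minors in the resulting expansion have determinants n and 1. The
-- inverse of Z is bidiagonal, so M + Mᵗ is tridiagonal, and its determinants
-- satisfy d(n+2) = 2 d(n+1) - d(n).
module Submission where

open import Defs
open import Data.Fin.Base using (Fin; zero; suc; toℕ; punchIn)
open import Data.Integer.Base
  using (ℤ; +_; 0ℤ; 1ℤ; -1ℤ; _+_; _-_; _*_; _^_)
open import Data.Integer.Properties
  using ( +-*-semiring; +-0-abelianGroup; +-identityˡ; +-identityʳ
        ; *-assoc; *-comm; *-identityˡ; *-zeroʳ; *-distribˡ-+)
open import Algebra.Properties.AbelianGroup +-0-abelianGroup using (identityʳ-unique)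
open import Algebra.Properties.Semiring.Sum +-*-semiring
  using ( sum; sum-cong-≗; sum-replicate-zero; ∑-distrib-+; ∑-comm
        ; *-distribˡ-sum; *-distribʳ-sum)
open import Data.Integer.Tactic.RingSolver using (solve-∀)
open import Data.Nat.Base using (ℕ; zero; suc; NonZero)
open import Data.Product.Base using (_×_; _,_; proj₁; proj₂)
open import Data.Vec.Functional using (Vector)
open import Function.Base using (_∘_)
open import Relation.Binary.PropositionalEquality
  using (_≡_; refl; sym; trans; cong; cong₂; module ≡-Reasoning)

open ≡-Reasoning

private
  variable
    n : ℕ

sum-zero : {v : Vector ℤ n} → (∀ i → v i ≡ 0ℤ) → sum v ≡ 0ℤ
sum-zero {n} v≡0 = trans (sum-cong-≗ v≡0) (sum-replicate-zero n)

-- Uniqueness of inverses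

⊗-congˡ : (A : Matrix n) {B C : Matrix n} → B ≋ C → A ⊗ B ≋ A ⊗ C
⊗-congˡ A B≋C i j = sum-cong-≗ λ k → cong (A i k *_) (B≋C k j)

⊗-congʳ : {A B : Matrix n} (C : Matrix n) → A ≋ B → A ⊗ C ≋ B ⊗ C
⊗-congʳ C A≋B i j = sum-cong-≗ λ k → cong (_* C k j) (A≋B i k)

⊗-assoc : (A B C : Matrix n) → (A ⊗ B) ⊗ C ≋ A ⊗ (B ⊗ C)
⊗-assoc {n} A B C i j = begin
  sum (λ k → sum (λ l → A i l * B l k) * C k j)
    ≡⟨ sum-cong-≗ (λ k → *-distribʳ-sum (C k j) (λ l → A i l * B l k)) ⟩
  sum (λ k → sum (λ l → A i l * B l k * C k j))
    ≡⟨ ∑-comm {n} {n} (λ k l → A i l * B l k * C k j) ⟩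
  sum (λ l → sum (λ k → A i l * B l k * C k j))
    ≡⟨ sum-cong-≗ (λ l → sum-cong-≗ λ k → *-assoc (A i l) (B l k) (C k j)) ⟩
  sum (λ l → sum (λ k → A i l * (B l k * C k j)))
    ≡⟨ sum-cong-≗ (λ l → *-distribˡ-sum (A i l) (λ k → B l k * C k j)) ⟨
  sum (λ l → A i l * sum (λ k → B l k * C k j)) ∎

sum-𝟙-* : (i : Fin n) (v : Vector ℤ n) → sum (λ k → 𝟙 i k * v k) ≡ v i
sum-𝟙-* {suc n} zero v = begin
  1ℤ * v zero + sum (λ k → 0ℤ * v (suc k))
    ≡⟨ cong₂ _+_ (*-identityˡ (v zero)) (sum-zero {n} λ _ → refl) ⟩
  v zero + 0ℤ  ≡⟨ +-identityʳ (v zero) ⟩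
  v zero       ∎
sum-𝟙-* (suc i) v = trans (+-identityˡ _) (sum-𝟙-* i (v ∘ suc))

𝟙-sym : (i j : Fin n) → 𝟙 i j ≡ 𝟙 j i
𝟙-sym zero    zero    = refl
𝟙-sym zero    (suc j) = refl
𝟙-sym (suc i) zero    = refl
𝟙-sym (suc i) (suc j) = 𝟙-sym i j

⊗-identityˡ : (A : Matrix n) → 𝟙 ⊗ A ≋ A
⊗-identityˡ A i j = sum-𝟙-* i (λ k → A k j)

⊗-identityʳ : (A : Matrix n) → A ⊗ 𝟙 ≋ A
⊗-identityʳ A i j = trans
  (sum-cong-≗ λ k → trans (*-comm (A i k) (𝟙 k j)) (cong (_* A i k) (𝟙-sym k j)))
  (sum-𝟙-* j (A i))

-- The usual chain B = B(AC) = (BA)C = C, using one side of each inverse. It lets an arbitrary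
-- inverse of the zeta matrix be replaced by an explicit one.
inverse-unique : {A B C : Matrix n} → B IsInverseOf A → C IsInverseOf A → B ≋ C
inverse-unique {A = A} {B} {C} (BA≋𝟙 , _) (_ , AC≋𝟙) i j = begin
  B i j              ≡⟨ ⊗-identityʳ B i j ⟨
  (B ⊗ 𝟙) i j        ≡⟨ ⊗-congˡ B AC≋𝟙 i j ⟨
  (B ⊗ (A ⊗ C)) i j  ≡⟨ ⊗-assoc B A C i j ⟨
  ((B ⊗ A) ⊗ C) i j  ≡⟨ ⊗-congʳ C BA≋𝟙 i j ⟩
  (𝟙 ⊗ C) i j        ≡⟨ ⊗-identityˡ C i j ⟩
  C i j              ∎

-- Determinants and the first column

-- The summand of `det`, named so that single terms of the expansion can be compared; `det A`
-- unfolds to `sum (laplace A)`.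
laplace : Matrix (suc n) → Vector ℤ (suc n)
laplace A j = -1ℤ ^ toℕ j * A zero j * det (minor A zero j)

det-cong : {A B : Matrix n} → A ≋ B → det A ≡ det B
det-cong {zero}  A≋B = refl
det-cong {suc n} A≋B = sum-cong-≗ λ j →
  cong₂ _*_ (cong (-1ℤ ^ toℕ j *_) (A≋B zero j))
            (det-cong λ k l → A≋B (suc k) (punchIn j l))

-- Mutual induction with the termwise version. In term 0 the minor omits column 0, so only the
-- coefficient splits. In every later term the coefficient is shared and the minor still contains
-- column 0, so the induction hypothesis splits the minor.
det-column₀-+ : (A B C : Matrix (suc n)) →
  (∀ i → A i zero ≡ B i zero + C i zero) →
  (∀ i j → B i (suc j) ≡ A i (suc j)) →
  (∀ i j → C i (suc j) ≡ A i (suc j)) →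
  det A ≡ det B + det C

laplace-column₀-+ : (A B C : Matrix (suc n)) →
  (∀ i → A i zero ≡ B i zero + C i zero) →
  (∀ i j → B i (suc j) ≡ A i (suc j)) →
  (∀ i j → C i (suc j) ≡ A i (suc j)) →
  ∀ j → laplace A j ≡ laplace B j + laplace C j

det-column₀-+ A B C A₀≡ B≡A C≡A = trans
  (sum-cong-≗ (laplace-column₀-+ A B C A₀≡ B≡A C≡A))
  (∑-distrib-+ (laplace B) (laplace C))

laplace-column₀-+ A B C A₀≡ B≡A C≡A zero = begin
  1ℤ * A zero zero * det (minor A zero zero)
    ≡⟨ cong (λ a → 1ℤ * a * det (minor A zero zero)) (A₀≡ zero) ⟩
  1ℤ * (B zero zero + C zero zero) * det (minor A zero zero)
    ≡⟨ distrib 1ℤ (B zero zero) (C zero zero) (det (minor A zero zero)) ⟩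
  1ℤ * B zero zero * det (minor A zero zero) + 1ℤ * C zero zero * det (minor A zero zero)
    ≡⟨ cong₂ (λ d e → 1ℤ * B zero zero * d + 1ℤ * C zero zero * e)
         (det-cong λ k l → B≡A (suc k) l) (det-cong λ k l → C≡A (suc k) l) ⟨
  laplace B zero + laplace C zero ∎
  where
  distrib : ∀ s b c d → s * (b + c) * d ≡ s * b * d + s * c * d
  distrib = solve-∀
laplace-column₀-+ {suc n} A B C A₀≡ B≡A C≡A (suc j) = begin
  s * A zero (suc j) * det (minor A zero (suc j))
    ≡⟨ cong (s * A zero (suc j) *_)
         (det-column₀-+ (minor A zero (suc j)) (minor B zero (suc j)) (minor C zero (suc j))
           (λ k → A₀≡ (suc k))
           (λ k l → B≡A (suc k) (punchIn j l))
           (λ k l → C≡A (suc k) (punchIn j l))) ⟩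
  s * A zero (suc j) * (det (minor B zero (suc j)) + det (minor C zero (suc j)))
    ≡⟨ *-distribˡ-+ (s * A zero (suc j)) _ _ ⟩
  s * A zero (suc j) * det (minor B zero (suc j)) + s * A zero (suc j) * det (minor C zero (suc j))
    ≡⟨ cong₂ (λ b c → s * b * det (minor B zero (suc j)) + s * c * det (minor C zero (suc j)))
         (B≡A zero j) (C≡A zero j) ⟨
  laplace B (suc j) + laplace C (suc j) ∎
  where
  s = -1ℤ ^ toℕ (suc j)

-- Such a matrix is its own sum in the sense of det-column₀-+.
det-column₀-zero : (A : Matrix (suc n)) → (∀ i → A i zero ≡ 0ℤ) → det A ≡ 0ℤ
det-column₀-zero A A₀≡0 = identityʳ-unique (det A) (det A)
  (sym (det-column₀-+ A A A A₀≡ (λ _ _ → refl) (λ _ _ → refl)))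
  where
  A₀≡ : ∀ i → A i zero ≡ A i zero + A i zero
  A₀≡ i rewrite A₀≡0 i = refl

-- Terms 0 and 1 have equal entries and equal minors but opposite signs, so they cancel. Every later
-- minor keeps both equal columns and vanishes by induction.
det-column₀≡column₁ : (A : Matrix (suc (suc n))) →
  (∀ i → A i zero ≡ A i (suc zero)) → det A ≡ 0ℤ

laplace-column₀≡column₁ : (A : Matrix (suc (suc n))) →
  (∀ i → A i zero ≡ A i (suc zero)) → ∀ j → laplace A (suc (suc j)) ≡ 0ℤ

det-column₀≡column₁ {n} A A₀≡A₁ = begin
  1ℤ * a₀ * d₀ + (-1ℤ * a₁ * d₁ + sum (λ j → laplace A (suc (suc j))))
    ≡⟨ cong₂ (λ a d → 1ℤ * a * d + (-1ℤ * a₁ * d₁ + sum (λ j → laplace A (suc (suc j)))))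
         (A₀≡A₁ zero) (det-cong minors) ⟩
  1ℤ * a₁ * d₁ + (-1ℤ * a₁ * d₁ + sum (λ j → laplace A (suc (suc j))))
    ≡⟨ cong (λ x → 1ℤ * a₁ * d₁ + (-1ℤ * a₁ * d₁ + x))
         (sum-zero {n} (laplace-column₀≡column₁ A A₀≡A₁)) ⟩
  1ℤ * a₁ * d₁ + (-1ℤ * a₁ * d₁ + 0ℤ)
    ≡⟨ cancel a₁ d₁ ⟩
  0ℤ ∎
  where
  a₀ = A zero zero
  a₁ = A zero (suc zero)
  d₀ = det (minor A zero zero)
  d₁ = det (minor A zero (suc zero))

  minors : minor A zero zero ≋ minor A zero (suc zero)
  minors k zero    = sym (A₀≡A₁ (suc k))
  minors k (suc l) = refl

  cancel : ∀ a d → 1ℤ * a * d + (-1ℤ * a * d + 0ℤ) ≡ 0ℤ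
  cancel = solve-∀

laplace-column₀≡column₁ {suc n} A A₀≡A₁ j = trans
  (cong (-1ℤ ^ toℕ (suc (suc j)) * A zero (suc (suc j)) *_)
    (det-column₀≡column₁ (minor A zero (suc (suc j))) (λ k → A₀≡A₁ (suc k))))
  (*-zeroʳ (-1ℤ ^ toℕ (suc (suc j)) * A zero (suc (suc j))))

-- Column operation: `B` is `A` with column 1 subtracted from column 0. By additivity the difference
-- is the determinant of `C`, which repeats column 1.
det-column₀-column₁ : (A B : Matrix (suc (suc n))) →
  (∀ i → A i zero ≡ B i zero + A i (suc zero)) →
  (∀ i j → B i (suc j) ≡ A i (suc j)) →
  det A ≡ det B
det-column₀-column₁ {n} A B A₀≡ B≡A = begin
  det A          ≡⟨ det-column₀-+ A B C A₀≡ B≡A (λ _ _ → refl) ⟩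
  det B + det C  ≡⟨ cong (λ x → det B + x) (det-column₀≡column₁ C λ _ → refl) ⟩
  det B + 0ℤ     ≡⟨ +-identityʳ (det B) ⟩
  det B          ∎
  where
  C : Matrix (suc (suc n))
  C i zero    = A i (suc zero)
  C i (suc j) = A i (suc j)

det-row₀-single : (A : Matrix (suc n)) → (∀ j → A zero (suc j) ≡ 0ℤ) →
  det A ≡ A zero zero * det (minor A zero zero)
det-row₀-single {n} A A₀≡0 = trans
  (cong₂ (λ a x → a * det (minor A zero zero) + x)
    (*-identityˡ (A zero zero)) (sum-zero {n} vanish))
  (+-identityʳ _)
  where
  vanish : ∀ j → laplace A (suc j) ≡ 0ℤ
  vanish j rewrite A₀≡0 j | *-zeroʳ (-1ℤ ^ toℕ (suc j)) = refl

det-column₀-single : (A : Matrix (suc n)) → (∀ i → A (suc i) zero ≡ 0ℤ) →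
  det A ≡ A zero zero * det (minor A zero zero)
det-column₀-single {n} A A₀≡0 = trans
  (cong₂ (λ a x → a * det (minor A zero zero) + x)
    (*-identityˡ (A zero zero)) (sum-zero {n} (vanish A A₀≡0)))
  (+-identityʳ _)
  where
  -- Generalised over the size to allow matching on it: a positive size gives the minor a first
  -- column, which is zero here.
  vanish : ∀ {n} (A : Matrix (suc n)) → (∀ i → A (suc i) zero ≡ 0ℤ) →
    ∀ j → laplace A (suc j) ≡ 0ℤ
  vanish {suc n} A A₀≡0 j = trans
    (cong (-1ℤ ^ toℕ (suc j) * A zero (suc j) *_)
      (det-column₀-zero (minor A zero (suc j)) A₀≡0))
    (*-zeroʳ (-1ℤ ^ toℕ (suc j) * A zero (suc j)))

-- Expansion along column 0, derived from the row expansion. Deleting row 0 and a later column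
-- leaves `a` as the only possibly nonzero entry of column 0; pulling `a` out of these terms leaves
-- the row expansion of `B`.
det-column₀-pair : (A : Matrix (suc (suc n))) →
  (∀ i → A (suc (suc i)) zero ≡ 0ℤ) →
  det A ≡ A zero zero * det (minor A zero zero)
        - A (suc zero) zero * det (minor A (suc zero) zero)
det-column₀-pair {n} A A₀≡0 = begin
  1ℤ * A zero zero * det (minor A zero zero) + sum (λ j → laplace A (suc j))
    ≡⟨ cong (λ x → 1ℤ * A zero zero * det (minor A zero zero) + x) (begin
         sum (λ j → laplace A (suc j))      ≡⟨ sum-cong-≗ term ⟩
         sum (λ j → -1ℤ * a * laplace B j)  ≡⟨ *-distribˡ-sum (-1ℤ * a) (laplace B) ⟨
         -1ℤ * a * det B                    ∎) ⟩
  1ℤ * A zero zero * det (minor A zero zero) + -1ℤ * a * det B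
    ≡⟨ signs (A zero zero) (det (minor A zero zero)) a (det B) ⟩
  A zero zero * det (minor A zero zero) - a * det B ∎
  where
  a = A (suc zero) zero
  B = minor A (suc zero) zero

  signs : ∀ a₀ d₀ a₁ d₁ → 1ℤ * a₀ * d₀ + -1ℤ * a₁ * d₁ ≡ a₀ * d₀ - a₁ * d₁
  signs = solve-∀

  reorder : ∀ s b a d → -1ℤ * s * b * (a * d) ≡ -1ℤ * a * (s * b * d)
  reorder = solve-∀

  term : ∀ j → laplace A (suc j) ≡ -1ℤ * a * laplace B j
  term j = trans
    (cong (-1ℤ ^ toℕ (suc j) * A zero (suc j) *_)
      (det-column₀-single (minor A zero (suc j)) A₀≡0))
    -- Removing rows 0 and 1 and columns 0 and `suc j` in either order gives the same matrix
    -- definitionally.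
    (reorder (-1ℤ ^ toℕ j) (B zero j) a (det (minor B zero j)))

-- The matrix Z + Zᵗ

-- The identity plus the all-ones matrix, with the (0,0) entry replaced by c.
𝟙+J[_] : ℤ → Matrix n
𝟙+J[ c ] zero    zero    = c
𝟙+J[ c ] zero    (suc j) = 1ℤ
𝟙+J[ c ] (suc i) zero    = 1ℤ
𝟙+J[ c ] (suc i) (suc j) = 𝟙+J[ + 2 ] i j

-- A variable corner keeps the family closed under the expansion: deleting row 0 gives corner 2,
-- while deleting row 1 keeps the all-ones rest of row 0 and gives corner 1.
det-𝟙+J-suc : ∀ n c →
  det {suc (suc n)} 𝟙+J[ c ] ≡ (c - 1ℤ) * det {suc n} 𝟙+J[ + 2 ] + det {suc n} 𝟙+J[ 1ℤ ]
det-𝟙+J-suc n c = begin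
  det {suc (suc n)} 𝟙+J[ c ]
    ≡⟨ det-column₀-column₁ 𝟙+J[ c ] B column₀ (λ _ _ → refl) ⟩
  det B
    ≡⟨ det-column₀-pair B (λ _ → refl) ⟩
  (c - 1ℤ) * det (minor B zero zero) - -1ℤ * det (minor B (suc zero) zero)
    ≡⟨ cong (λ d → (c - 1ℤ) * det {suc n} 𝟙+J[ + 2 ] - -1ℤ * d) (det-cong minor₁₀) ⟩
  (c - 1ℤ) * det {suc n} 𝟙+J[ + 2 ] - -1ℤ * det {suc n} 𝟙+J[ 1ℤ ]
    ≡⟨ signs ((c - 1ℤ) * det {suc n} 𝟙+J[ + 2 ]) (det {suc n} 𝟙+J[ 1ℤ ]) ⟩
  (c - 1ℤ) * det {suc n} 𝟙+J[ + 2 ] + det {suc n} 𝟙+J[ 1ℤ ] ∎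
  where
  -- Column 0 minus column 1: the entries are c - 1, then 1 - 2, then 1 - 1.
  B : Matrix (suc (suc n))
  B i             (suc j) = 𝟙+J[ c ] i (suc j)
  B zero          zero    = c - 1ℤ
  B (suc zero)    zero    = -1ℤ
  B (suc (suc i)) zero    = 0ℤ

  c≡c-1+1 : ∀ c → c ≡ c - 1ℤ + 1ℤ
  c≡c-1+1 = solve-∀

  signs : ∀ x y → x - -1ℤ * y ≡ x + y
  signs = solve-∀

  column₀ : ∀ i → 𝟙+J[ c ] i zero ≡ B i zero + 𝟙+J[ c ] i (suc zero)
  column₀ zero          = c≡c-1+1 c
  column₀ (suc zero)    = refl
  column₀ (suc (suc i)) = refl

  minor₁₀ : minor B (suc zero) zero ≋ 𝟙+J[ 1ℤ ]
  minor₁₀ zero    zero    = refl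
  minor₁₀ zero    (suc l) = refl
  minor₁₀ (suc k) zero    = refl
  minor₁₀ (suc k) (suc l) = refl

-- For c = 1 the coefficient c - 1 kills the first term of the recurrence.
det-𝟙+J[1] : ∀ n → det {suc n} 𝟙+J[ 1ℤ ] ≡ 1ℤ
det-𝟙+J[1] zero    = refl
det-𝟙+J[1] (suc n) =
  trans (det-𝟙+J-suc n 1ℤ) (trans (+-identityˡ _) (det-𝟙+J[1] n))

det-𝟙+J[2] : ∀ n → det {n} 𝟙+J[ + 2 ] ≡ + suc n
det-𝟙+J[2] zero          = refl
det-𝟙+J[2] (suc zero)    = refl
det-𝟙+J[2] (suc (suc n)) = begin
  det {suc (suc n)} 𝟙+J[ + 2 ]
    ≡⟨ det-𝟙+J-suc n (+ 2) ⟩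
  1ℤ * det {suc n} 𝟙+J[ + 2 ] + det {suc n} 𝟙+J[ 1ℤ ]
    ≡⟨ cong₂ (λ x y → 1ℤ * x + y) (det-𝟙+J[2] (suc n)) (det-𝟙+J[1] n) ⟩
  1ℤ * + suc (suc n) + 1ℤ
    ≡⟨ swap (+ suc (suc n)) ⟩
  + suc (suc (suc n)) ∎
  where
  swap : ∀ x → 1ℤ * x + 1ℤ ≡ 1ℤ + x
  swap = solve-∀

Z-suc : (i j : Fin n) → Z[ suc n ] (suc i) (suc j) ≡ Z[ n ] i j
Z-suc zero    j       = refl
Z-suc (suc i) zero    = refl
Z-suc (suc i) (suc j) = refl

-- In a chain, distinct elements are comparable in exactly one direction, giving 1 off the diagonal;
-- reflexivity counts twice on it.
Z⊕Zᵗ : ∀ n → Z[ n ] ⊕ Z[ n ] ᵗ ≋ 𝟙+J[ + 2 ]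
Z⊕Zᵗ (suc n) zero    zero    = refl
Z⊕Zᵗ (suc n) zero    (suc j) = refl
Z⊕Zᵗ (suc n) (suc i) zero    = refl
Z⊕Zᵗ (suc n) (suc i) (suc j) =
  trans (cong₂ _+_ (Z-suc i j) (Z-suc j i)) (Z⊕Zᵗ n i j)

-- The matrix M + Mᵗ

-- The bidiagonal witness, with 1 on the diagonal and -1 just above it. Its entries compute, so
-- facts about them hold by `refl`.
Z⁻¹[_] : ∀ n → Matrix n
Z⁻¹[ n ] = proj₁ (Z-invertible n)

det-Z⁻¹-suc-suc : ∀ n → let d = λ n → det (Z⁻¹[ n ] ⊕ Z⁻¹[ n ] ᵗ) in
  d (suc (suc n)) ≡ + 2 * d (suc n) - d n
det-Z⁻¹-suc-suc n = begin
  det A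
    ≡⟨ det-column₀-pair A (λ _ → refl) ⟩
  + 2 * det (minor A zero zero) - -1ℤ * det (minor A (suc zero) zero)
    ≡⟨ cong (λ d → + 2 * det (minor A zero zero) - -1ℤ * d)
         -- Row 0 of this minor is (-1, 0, ..., 0), and deleting its first row and column leaves the
         -- matrix of size n.
         (det-row₀-single (minor A (suc zero) zero) (λ _ → refl)) ⟩
  + 2 * det (minor A zero zero) - -1ℤ * (-1ℤ * d)
    ≡⟨ signs (+ 2 * det (minor A zero zero)) d ⟩
  + 2 * det (minor A zero zero) - d ∎
  where
  A = Z⁻¹[ suc (suc n) ] ⊕ Z⁻¹[ suc (suc n) ] ᵗ
  d = det (Z⁻¹[ n ] ⊕ Z⁻¹[ n ] ᵗ)

  signs : ∀ x y → x - -1ℤ * (-1ℤ * y) ≡ x - y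
  signs = solve-∀

det-Z⁻¹ : ∀ n → det (Z⁻¹[ n ] ⊕ Z⁻¹[ n ] ᵗ) ≡ + suc n
det-Z⁻¹ zero          = refl
det-Z⁻¹ (suc zero)    = refl
det-Z⁻¹ (suc (suc n)) = begin
  det (Z⁻¹[ suc (suc n) ] ⊕ Z⁻¹[ suc (suc n) ] ᵗ)
    ≡⟨ det-Z⁻¹-suc-suc n ⟩
  + 2 * det (Z⁻¹[ suc n ] ⊕ Z⁻¹[ suc n ] ᵗ) - det (Z⁻¹[ n ] ⊕ Z⁻¹[ n ] ᵗ)
    ≡⟨ cong₂ (λ x y → + 2 * x - y) (det-Z⁻¹ (suc n)) (det-Z⁻¹ n) ⟩
  -- Writing n + 2 as 1 + (n + 1), which is definitional, leaves a ring identity in the single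
  -- variable n + 1.
  + 2 * (1ℤ + + suc n) - + suc n
    ≡⟨ arith (+ suc n) ⟩
  + suc (suc (suc n)) ∎
  where
  arith : ∀ x → + 2 * (1ℤ + x) - x ≡ + 2 + x
  arith = solve-∀

lemma2 : (n : ℕ) → .{{_ : NonZero n}} →
    (M : Matrix n) → M IsInverseOf Z[ n ] →
    det (Z[ n ] ⊕ Z[ n ] ᵗ) ≡ + suc n × det (M ⊕ M ᵗ) ≡ + suc n
lemma2 n M M-inverse =
  trans (det-cong (Z⊕Zᵗ n)) (det-𝟙+J[2] n) ,
  trans (det-cong λ i j → cong₂ _+_ (M≋Z⁻¹ i j) (M≋Z⁻¹ j i)) (det-Z⁻¹ n)
  where
  M≋Z⁻¹ : M ≋ Z⁻¹[ n ]
  M≋Z⁻¹ = inverse-unique M-inverse (proj₂ (Z-invertible n))
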